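{- Let $\mathbf v$ be a complementary symmetric Rote sequence associated with a standard Sturmian sequence $\mathbf u=\mathcal S(\mathbf v)$. Then $\mathbf v$ is primitive substitutive if and only if $\mathbf u$ is primitive substitutive.
   Context: A Sturmian sequence is a sequence over $\{0,1\}$ with factor complexity $n+1$; it is standard if $0\mathbf u,1\mathbf u$ are Sturmian. A complementary symmetric Rote sequence is a sequence over $\{0,1\}$ with factor complexity $2n$ ($n\ge1$) whose set of factors is closed under $0\leftrightarrow1$; it is associated with $\mathcal S(\mathbf v)=u_0u_1\cdots$ where $u_i=v_i+v_{i+1}\bmod 2$. A morphism $\psi$ over an alphabet is primitive if some power of its matrix $M_\psi$ ($(M_\psi)_{ab}=|\psi(a)|_b$) has all entries positive. A sequence $\mathbf w\in\mathcal A^{\mathbb N}$ is primitive substitutive if $\mathbf w=\sigma(\mathbf y)$ for some morphism $\sigma:\mathcal B^*\to\mathcal A^*$ and some sequence $\mathbf y\in\mathcal B^{\mathbb N}$ that is a fixed point of a primitive morphism over $\mathcal B$. -}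

module Defs where

open import Data.Nat using (ℕ; zero; suc; _+_; _*_; _≥_; _≤_; _<_)
open import Data.Bool using (Bool; true; false; _xor_)
open import Data.Fin using (Fin)
open import Data.Fin.Properties using () renaming (_≟_ to _≟F_)
open import Data.List using (List; []; _∷_; length; _++_; concatMap)
open import Data.List.Relation.Unary.All using (All)
open import Data.List.Relation.Unary.Unique.Propositional using (Unique)
open import Data.List.Membership.Propositional using (_∈_)
open import Data.List.Relation.Binary.Prefix.Heterogeneous using (Prefix)
open import Data.Vec using (Vec; tabulate)
open import Data.Product using (Σ; ∃; _×_; _,_)
open import Relation.Binary.PropositionalEquality using (_≡_)
open import Relation.Nullary using (yes; no)

Seq : Set → Set
Seq A = ℕ → A

-- Binary sequences: the alphabet {0,1} is represented by Bool (0 = false, 1 = true).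
BinSeq : Set
BinSeq = Seq Bool

window : {A : Set} → Seq A → ℕ → (n : ℕ) → Vec A n
window w i n = tabulate (λ j → w (i + Data.Fin.toℕ j))

IsFactor : {A : Set} → Seq A → {n : ℕ} → Vec A n → Set
IsFactor w {n} x = ∃ λ i → window w i n ≡ x

ComplexityEq : BinSeq → ℕ → ℕ → Set
ComplexityEq w n k =
  Σ (List (Vec Bool n)) λ L →
    Unique L × All (IsFactor w) L × (∀ i → window w i n ∈ L) × length L ≡ k

Sturmian : BinSeq → Set
Sturmian u = ∀ n → ComplexityEq u n (suc n)

cons : {A : Set} → A → Seq A → Seq A
cons a u zero = a
cons a u (suc i) = u i

StandardSturmian : BinSeq → Set
StandardSturmian u = Sturmian u × Sturmian (cons false u) × Sturmian (cons true u)

complement : {n : ℕ} → Vec Bool n → Vec Bool n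
complement = Data.Vec.map Data.Bool.not

CSRote : BinSeq → Set
CSRote v = (∀ n → n ≥ 1 → ComplexityEq v n (2 * n))
         × (∀ {n} (x : Vec Bool n) → IsFactor v x → IsFactor v (complement x))

S : BinSeq → BinSeq
S v i = v i xor v (suc i)

prefixList : {A : Set} → Seq A → ℕ → List A
prefixList w zero = []
prefixList w (suc n) = prefixList w n ++ (w n ∷ [])

applyMorph : {A B : Set} → (B → List A) → List B → List A
applyMorph σ = concatMap σ

-- w = σ(y) for an infinite sequence y: every σ(y_0 ... y_{n-1}) is a prefix of w
-- and these images are unboundedly long (so σ(y) is an infinite sequence equal to w).
IsImage : {A B : Set} → (B → List A) → Seq B → Seq A → Set
IsImage σ y w =
  (∀ n → Prefix _≡_ (applyMorph σ (prefixList y n)) (prefixList w (length (applyMorph σ (prefixList y n)))))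
  × (∀ m → ∃ λ n → m ≤ length (applyMorph σ (prefixList y n)))

IsFixedPoint : {B : Set} → (B → List B) → Seq B → Set
IsFixedPoint φ y = IsImage φ y y

count : {k : ℕ} → Fin k → List (Fin k) → ℕ
count b [] = 0
count b (c ∷ x) with c ≟F b
... | yes _ = suc (count b x)
... | no _ = count b x

Mat : ℕ → Set
Mat k = Fin k → Fin k → ℕ

sumFin : {k : ℕ} → (Fin k → ℕ) → ℕ
sumFin {zero} f = 0
sumFin {suc k} f = f Fin.zero + sumFin (λ i → f (Fin.suc i))

_·_ : {k : ℕ} → Mat k → Mat k → Mat k
(M · N) a c = sumFin (λ b → M a b * N b c)

powSuc : {k : ℕ} → Mat k → ℕ → Mat k
powSuc M zero = M
powSuc M (suc p) = powSuc M p · M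

morphMatrix : {k : ℕ} → (Fin k → List (Fin k)) → Mat k
morphMatrix φ a b = count b (φ a)

Primitive : {k : ℕ} → (Fin k → List (Fin k)) → Set
Primitive φ = ∃ λ p → ∀ a b → 0 < powSuc (morphMatrix φ) p a b

PrimitiveSubstitutive : BinSeq → Set
PrimitiveSubstitutive w =
  ∃ λ (k : ℕ) → ∃ λ (σ : Fin k → List Bool) → ∃ λ (φ : Fin k → List (Fin k)) →
    ∃ λ (y : Seq (Fin k)) → Primitive φ × IsFixedPoint φ y × IsImage σ y w

{-# OPTIONS --safe #-}
-- Given w = σ(y) with y fixed by a primitive φ, label each y_i by a bit x_i: to pass from v to u,
-- the first letter of σ(y_{i+1}); to pass from u to v, the sum of σ(y_0 ⋯ y_{i-1}) modulo 2 (plus v_0).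
-- The labelled letters determine the corresponding blocks of the other sequence. If σ(φ(a)) and σ(a)
-- have the same first letter (the same sum modulo 2) for every a, then φ lifts to a substitution on
-- labelled letters fixing (y_i , x_i)_i; since there are finitely many functions from letters to bits,
-- this is achieved by replacing φ with a power and σ with σ ∘ φⁿ. The lifted substitution need not be
-- primitive, but its first letter recurs from every letter that occurs, so its restriction to the
-- occurring letters is primitive. In the running-sum case, the first letter z₀ is recovered from its
-- label-flipped copy by symmetry: if flip(z₀) occurs in Φⁿ(z₀), then z₀ occurs in Φⁿ(flip(z₀)).
module Submission where

open import Defs
open import Data.Bool using (Bool; true; false; not; _xor_)
open import Data.Bool.Properties using (xor-assoc; xor-same; xor-identityʳ; not-distribˡ-xor)
import Data.Bool.Properties as Bool
open import Data.Fin using (Fin; zero; suc; toℕ; funToFin; finToFun)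
open import Data.Fin.Properties using (pigeonhole; finToFun-funToFin; 2↔Bool; *↔×) renaming (_≟_ to _≟F_)
open import Data.List using (List; []; _∷_; [_]; _++_; length; map; concatMap; lookup; deduplicate)
open import Data.List.Properties using
  ( concatMap-pure; concatMap-map; concatMap-++; map-++
  ; ++-assoc; ++-identityʳ; ++-cancelˡ; ∷-injectiveˡ; length-++)
open import Data.List.Membership.Propositional using (_∈_; find; lose)
open import Data.List.Membership.Propositional.Properties using
  ( ∈-concatMap⁺; ∈-concatMap⁻; ∈-++⁺ˡ; ∈-++⁺ʳ; ∈-++⁻; ∈-lookup
  ; ∈-deduplicate⁺; ∈-deduplicate⁻)
import Data.List.Membership.DecPropositional as DecMembership
open import Data.List.Relation.Binary.Pointwise using (Pointwise-≡⇒≡; ≡⇒Pointwise-≡)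
open import Data.List.Relation.Binary.Prefix.Heterogeneous using (Prefix)
open import Data.List.Relation.Binary.Prefix.Heterogeneous.Properties using (fromPointwise; toPointwise)
import Data.List.Relation.Unary.All as All
open import Data.List.Relation.Unary.AllPairs using (_∷_)
open import Data.List.Relation.Unary.Any using (here; there; index)
open import Data.List.Relation.Unary.Any.Properties using (lookup-index)
open import Data.List.Relation.Unary.Unique.Propositional using (Unique)
import Data.List.Relation.Unary.Unique.DecPropositional.Properties as DecUnique
open import Data.Nat using (ℕ; zero; suc; _+_; _*_; _∸_; _^_; _≤_; _<_; z≤n; s≤s)
open import Data.Nat.Properties
open import Data.Product using (∃; ∃₂; _×_; _,_; proj₁; proj₂; uncurry)
open import Data.Product.Function.NonDependent.Propositional using (_×-↔_)
open import Data.Product.Properties using (≡-dec)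
open import Data.Sum using (inj₁; inj₂)
open import Function using (_∘_; id; _↔_; Inverse; mk⇔)
open import Function.Bundles using (_⇔_)
open import Function.Construct.Composition using (_↔-∘_)
open import Function.Construct.Identity using (↔-id)
open import Relation.Binary.Definitions using (DecidableEquality)
open import Relation.Binary.PropositionalEquality hiding ([_])
open import Relation.Nullary using (yes; no; does; contradiction)

private variable
  A B C : Set
  k : ℕ

-- Auxiliary facts on lists and `concatMap`

∈-concatMap-intro : (f : A → List B) {a : A} {b : B} {xs : List A} → a ∈ xs → b ∈ f a → b ∈ concatMap f xs
∈-concatMap-intro f a∈xs b∈fa = ∈-concatMap⁺ f (lose a∈xs b∈fa)

∈-concatMap-elim : (f : A → List B) {b : B} (xs : List A) → b ∈ concatMap f xs → ∃ λ a → a ∈ xs × b ∈ f a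
∈-concatMap-elim f xs = find ∘ ∈-concatMap⁻ f {xs = xs}

concatMap-concatMap : (g : B → List C) (f : A → List B) (xs : List A) →
  concatMap g (concatMap f xs) ≡ concatMap (concatMap g ∘ f) xs
concatMap-concatMap g f [] = refl
concatMap-concatMap g f (x ∷ xs) =
  trans (concatMap-++ g (f x) (concatMap f xs)) (cong (concatMap g (f x) ++_) (concatMap-concatMap g f xs))

concatMap-cong-∈ : {f g : A → List B} (xs : List A) → (∀ {a} → a ∈ xs → f a ≡ g a) → concatMap f xs ≡ concatMap g xs
concatMap-cong-∈ [] eq = refl
concatMap-cong-∈ (x ∷ xs) eq = cong₂ _++_ (eq (here refl)) (concatMap-cong-∈ xs (eq ∘ there))

length-concatMap-≥ : (f : A → List B) (n : ℕ) → (∀ a → n ≤ length (f a)) →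
  ∀ xs → length xs * n ≤ length (concatMap f xs)
length-concatMap-≥ f n long [] = z≤n
length-concatMap-≥ f n long (x ∷ xs) =
  ≤-trans (+-mono-≤ (long x) (length-concatMap-≥ f n long xs)) (≤-reflexive (sym (length-++ (f x))))

∈-length : {a : A} {xs : List A} → a ∈ xs → 1 ≤ length xs
∈-length (here _) = s≤s z≤n
∈-length (there _) = s≤s z≤n

lookup-injective : {xs : List A} → Unique xs → ∀ i j → lookup xs i ≡ lookup xs j → i ≡ j
lookup-injective (_ ∷ _) zero zero _ = refl
lookup-injective (x∉ ∷ _) zero (suc j) eq = contradiction eq (All.lookup x∉ (∈-lookup j))
lookup-injective (x∉ ∷ _) (suc i) zero eq = contradiction (sym eq) (All.lookup x∉ (∈-lookup i))
lookup-injective (_ ∷ uniq) (suc i) (suc j) eq = cong suc (lookup-injective uniq i j eq)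

-- Prefixes of sequences

length-prefixList : (w : Seq A) (n : ℕ) → length (prefixList w n) ≡ n
length-prefixList w zero = refl
length-prefixList w (suc n) =
  trans (length-++ (prefixList w n)) (trans (+-comm _ 1) (cong suc (length-prefixList w n)))

prefixList-+ : (w : Seq A) (m n : ℕ) → ∃ λ xs → prefixList w (n + m) ≡ prefixList w m ++ xs
prefixList-+ w m zero = [] , sym (++-identityʳ _)
prefixList-+ w m (suc n) with prefixList-+ w m n
... | xs , eq = xs ++ [ w (n + m) ] , trans (cong (_++ _) eq) (++-assoc (prefixList w m) xs _)

prefixList-≤ : (w : Seq A) {m n : ℕ} → m ≤ n → ∃ λ xs → prefixList w n ≡ prefixList w m ++ xs
prefixList-≤ w {m} {n} m≤n with prefixList-+ w m (n ∸ m)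
... | xs , eq = xs , trans (cong (prefixList w) (sym (m∸n+n≡m m≤n))) eq

∈-prefixList⁺ : (w : Seq A) {i n : ℕ} → i < n → w i ∈ prefixList w n
∈-prefixList⁺ w {i} i<n with prefixList-≤ w i<n
... | xs , eq = subst (w i ∈_) (sym eq) (∈-++⁺ˡ (∈-++⁺ʳ (prefixList w i) (here refl)))

∈-prefixList⁻ : (w : Seq A) {a : A} (n : ℕ) → a ∈ prefixList w n → ∃ λ i → w i ≡ a
∈-prefixList⁻ w (suc n) a∈ with ∈-++⁻ (prefixList w n) a∈
... | inj₁ a∈′ = ∈-prefixList⁻ w n a∈′
... | inj₂ (here refl) = n , refl

-- Comparing lengths gives `m < n`, so both sides extend the prefix of length `m` and can be
-- compared at the next letter. It locates the start of a block in `next-label`.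
prefixList-next : (w : Seq A) {c : A} {xs : List A} (m n : ℕ) →
  prefixList w m ++ c ∷ xs ≡ prefixList w n → w m ≡ c
prefixList-next w {c} {xs} m n eq with prefixList-≤ w {suc m} {n} m<n
  where
  m<n : m < n
  m<n = subst₂ _<_ (length-prefixList w m)
          (trans (trans (sym (length-++ (prefixList w m))) (cong length eq)) (length-prefixList w n))
          (m<m+n (length (prefixList w m)) (s≤s z≤n))
... | ys , eq′ = sym (∷-injectiveˡ (++-cancelˡ (prefixList w m) _ _
        (trans eq (trans eq′ (++-assoc (prefixList w m) [ w m ] ys)))))

prefixList-map : (f : A → B) (w : Seq A) (n : ℕ) → prefixList (f ∘ w) n ≡ map f (prefixList w n)
prefixList-map f w zero = refl
prefixList-map f w (suc n) =
  trans (cong (_++ [ f (w n) ]) (prefixList-map f w n)) (sym (map-++ f (prefixList w n) [ w n ]))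

prefixList-cong : {w w′ : Seq A} → (∀ i → w i ≡ w′ i) → ∀ n → prefixList w n ≡ prefixList w′ n
prefixList-cong eq zero = refl
prefixList-cong eq (suc n) = cong₂ (λ xs a → xs ++ [ a ]) (prefixList-cong eq n) (eq n)

-- Images of sequences under morphisms

-- Unlike in `IsImage`, the prefix condition is an equation between lists whose length is
-- existentially quantified, so that images compose by rewriting.
record Image (σ : B → List A) (y : Seq B) (w : Seq A) : Set where
  constructor _,_
  field
    prefix    : ∀ n → ∃ λ m → concatMap σ (prefixList y n) ≡ prefixList w m
    unbounded : ∀ m → ∃ λ n → m ≤ length (concatMap σ (prefixList y n))

IsImage⇒Image : {σ : B → List A} {y : Seq B} {w : Seq A} → IsImage σ y w → Image σ y w
IsImage⇒Image {σ = σ} {y} {w} (prefix , unbounded) =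
  (λ n → length (concatMap σ (prefixList y n)) ,
    Pointwise-≡⇒≡ (toPointwise (sym (length-prefixList w _)) (prefix n))) , unbounded

Image⇒IsImage : {σ : B → List A} {y : Seq B} {w : Seq A} → Image σ y w → IsImage σ y w
Image⇒IsImage {σ = σ} {y} {w} (prefix , unbounded) = isPrefix , unbounded
  where
  isPrefix : ∀ n → Prefix _≡_ (concatMap σ (prefixList y n)) (prefixList w (length (concatMap σ (prefixList y n))))
  isPrefix n with prefix n
  ... | m , eq rewrite eq | length-prefixList w m = fromPointwise (≡⇒Pointwise-≡ refl)

image-cong : {σ : B → List A} {y : Seq B} {w w′ : Seq A} → (∀ i → w i ≡ w′ i) → Image σ y w → Image σ y w′
image-cong w≗w′ (prefix , unbounded) =
  (λ n → proj₁ (prefix n) , trans (proj₂ (prefix n)) (prefixList-cong w≗w′ (proj₁ (prefix n)))) , unbounded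

_⊙_ : (B → List C) → (A → List B) → A → List C
(τ ⊙ σ) a = concatMap τ (σ a)

image-⊙ : {τ : B → List C} {σ : A → List B} {x : Seq A} {y : Seq B} {z : Seq C} →
  Image τ y z → Image σ x y → Image (τ ⊙ σ) x z
image-⊙ {τ = τ} {σ} {x} {y} {z} (prefixτ , unboundedτ) (prefixσ , unboundedσ) = prefix , unbounded
  where
  prefix : ∀ n → ∃ λ m → concatMap (τ ⊙ σ) (prefixList x n) ≡ prefixList z m
  prefix n with prefixσ n
  ... | m , eq with prefixτ m
  ... | l , eq′ = l , trans (sym (concatMap-concatMap τ σ (prefixList x n))) (trans (cong (concatMap τ) eq) eq′)

  unbounded : ∀ m → ∃ λ n → m ≤ length (concatMap (τ ⊙ σ) (prefixList x n))
  -- First `n₁` letters of `y` with a long enough image under `τ`, then `n₂` letters of `x` whose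
  -- image under `σ` covers those `n₁` letters.
  unbounded m with unboundedτ m
  ... | n₁ , m≤ with unboundedσ n₁
  ... | n₂ , n₁≤ with prefixσ n₂
  ... | l , eq with prefixList-≤ y {n₁} {l}
                      (subst (n₁ ≤_) (trans (cong length eq) (length-prefixList y l)) n₁≤)
  ... | xs , eq′ = n₂ , (begin
    m                                                                   ≤⟨ m≤ ⟩
    length (concatMap τ (prefixList y n₁))                              ≤⟨ m≤m+n _ _ ⟩
    length (concatMap τ (prefixList y n₁)) + length (concatMap τ xs)    ≡⟨ length-++ (concatMap τ (prefixList y n₁)) ⟨
    length (concatMap τ (prefixList y n₁) ++ concatMap τ xs)            ≡⟨ cong length (concatMap-++ τ (prefixList y n₁) xs) ⟨
    length (concatMap τ (prefixList y n₁ ++ xs))                        ≡⟨ cong (length ∘ concatMap τ) (trans eq eq′) ⟨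
    length (concatMap τ (concatMap σ (prefixList x n₂)))                ≡⟨ cong length (concatMap-concatMap τ σ (prefixList x n₂)) ⟩
    length (concatMap (τ ⊙ σ) (prefixList x n₂))                        ∎)
    where open ≤-Reasoning

image-map : (f : A → B) (w : Seq A) → Image ([_] ∘ f) w (f ∘ w)
image-map f w = (λ n → n , eq n) , λ m → m , ≤-reflexive (sym (trans (cong length (eq m)) (length-prefixList (f ∘ w) m)))
  where
  eq : ∀ n → concatMap ([_] ∘ f) (prefixList w n) ≡ prefixList (f ∘ w) n
  eq n = trans (sym (concatMap-map [_] f (prefixList w n)))
           (trans (concatMap-pure (map f (prefixList w n))) (sym (prefixList-map f w n)))

-- Powers of morphisms

pow : (A → List A) → ℕ → A → List A
pow φ zero = [_]
pow φ (suc n) = φ ⊙ pow φ n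

Positive Expanding : (A → List A) → Set
Positive φ = ∀ a b → b ∈ φ a
Expanding φ = ∀ a → 2 ≤ length (φ a)

pow-+ : (φ : A → List A) (m n : ℕ) (a : A) → pow φ (m + n) a ≡ concatMap (pow φ m) (pow φ n a)
pow-+ φ zero n a = sym (concatMap-pure _)
pow-+ φ (suc m) n a = trans (cong (concatMap φ) (pow-+ φ m n a)) (concatMap-concatMap φ (pow φ m) (pow φ n a))

pow-1 : (φ : A → List A) {a b : A} → b ∈ φ a → b ∈ pow φ 1 a
pow-1 φ b∈ = ∈-++⁺ˡ b∈

∈-pow-+ : (φ : A → List A) {a b c : A} (m n : ℕ) → b ∈ pow φ n a → c ∈ pow φ m b → c ∈ pow φ (m + n) a
∈-pow-+ φ {a} {c = c} m n b∈ c∈ = subst (c ∈_) (sym (pow-+ φ m n a)) (∈-concatMap-intro (pow φ m) b∈ c∈)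

∈-pow-self : (φ : A → List A) {a : A} → a ∈ φ a → ∀ n → a ∈ pow φ n a
∈-pow-self φ a∈ zero = here refl
∈-pow-self φ a∈ (suc n) = ∈-concatMap-intro φ (∈-pow-self φ a∈ n) a∈

-- Each application at least doubles the length; a linear bound is enough to reach every position of
-- a fixed point.
expanding-pow : {φ : A → List A} → Expanding φ → ∀ n a → suc n ≤ length (pow φ n a)
expanding-pow long zero a = s≤s z≤n
expanding-pow {φ = φ} long (suc n) a = begin
  suc (suc n)                 ≤⟨ s≤s (m≤n+m (suc n) n) ⟩
  suc (n + suc n)             ≡⟨ cong (suc n +_) (sym (+-identityʳ (suc n))) ⟩
  2 * suc n                   ≡⟨ *-comm 2 (suc n) ⟩
  suc n * 2                   ≤⟨ *-monoˡ-≤ 2 (expanding-pow long n a) ⟩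
  length (pow φ n a) * 2      ≤⟨ length-concatMap-≥ φ 2 long (pow φ n a) ⟩
  length (pow φ (suc n) a)    ∎
  where open ≤-Reasoning

-- Since `a` occurs in `φ a`, it survives the first `n` applications, and the last one produces
-- every letter.
positive-pow : {φ : A → List A} → Positive φ → ∀ n → Positive (pow φ (suc n))
positive-pow {φ = φ} pos n a b = ∈-concatMap-intro φ (∈-pow-self φ (pos a a) n) (pos a b)

image-pow : {φ : A → List A} {y : Seq A} → Image φ y y → ∀ n → Image (pow φ n) y y
image-pow {y = y} fix zero = image-map id y
image-pow fix (suc n) = image-⊙ fix (image-pow fix n)

-- Primitivity in terms of the letters occurring in powers

∈⇒count>0 : {b : Fin k} {xs : List (Fin k)} → b ∈ xs → 0 < count b xs
∈⇒count>0 {b = b} {c ∷ xs} b∈ with c ≟F b | b∈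
... | yes _ | _ = s≤s z≤n
... | no c≢b | here b≡c = contradiction (sym b≡c) c≢b
... | no _ | there b∈xs = ∈⇒count>0 b∈xs

count>0⇒∈ : {b : Fin k} (xs : List (Fin k)) → 0 < count b xs → b ∈ xs
count>0⇒∈ {b = b} (c ∷ xs) pos with c ≟F b
... | yes c≡b = here (sym c≡b)
... | no _ = there (count>0⇒∈ xs pos)

term>0⇒sumFin>0 : (f : Fin k → ℕ) (i : Fin k) → 0 < f i → 0 < sumFin f
term>0⇒sumFin>0 f zero pos = ≤-trans pos (m≤m+n _ _)
term>0⇒sumFin>0 f (suc i) pos = ≤-trans (term>0⇒sumFin>0 (f ∘ suc) i pos) (m≤n+m _ _)

sumFin>0⇒term>0 : (f : Fin k → ℕ) → 0 < sumFin f → ∃ λ i → 0 < f i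
sumFin>0⇒term>0 {suc k} f pos with f zero in eq
... | suc n = zero , subst (0 <_) (sym eq) (s≤s z≤n)
... | zero with sumFin>0⇒term>0 (f ∘ suc) pos
... | i , fi>0 = suc i , fi>0

*>0⇒both>0 : ∀ m n → 0 < m * n → 0 < m × 0 < n
*>0⇒both>0 (suc m) (suc n) _ = s≤s z≤n , s≤s z≤n
*>0⇒both>0 (suc m) zero pos with () ← subst (0 <_) (*-zeroʳ m) pos

-- `powSuc M p` has exponent `suc p`. Both `powSuc` and `pow` apply the last factor on the outside,
-- so the summation index of the matrix product is the intermediate letter `c`.
∈-pow⇒powSuc>0 : (φ : Fin k → List (Fin k)) (p : ℕ) {a b : Fin k} →
  b ∈ pow φ (suc p) a → 0 < powSuc (morphMatrix φ) p a b
∈-pow⇒powSuc>0 φ zero {a} b∈ = ∈⇒count>0 (subst (_ ∈_) (++-identityʳ (φ a)) b∈)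
∈-pow⇒powSuc>0 φ (suc p) {a} {b} b∈ with ∈-concatMap-elim φ (pow φ (suc p) a) b∈
... | c , c∈ , b∈φc =
  term>0⇒sumFin>0 (λ c → powSuc (morphMatrix φ) p a c * count b (φ c)) c
    (*-mono-≤ (∈-pow⇒powSuc>0 φ p c∈) (∈⇒count>0 b∈φc))

powSuc>0⇒∈-pow : (φ : Fin k → List (Fin k)) (p : ℕ) {a b : Fin k} →
  0 < powSuc (morphMatrix φ) p a b → b ∈ pow φ (suc p) a
powSuc>0⇒∈-pow φ zero {a} pos = pow-1 φ (count>0⇒∈ (φ a) pos)
powSuc>0⇒∈-pow φ (suc p) {a} {b} pos with sumFin>0⇒term>0 (λ c → powSuc (morphMatrix φ) p a c * count b (φ c)) pos
... | c , term>0 with *>0⇒both>0 (powSuc (morphMatrix φ) p a c) (count b (φ c)) term>0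
... | left , right = ∈-concatMap-intro φ (powSuc>0⇒∈-pow φ p left) (count>0⇒∈ (φ c) right)

-- Substitutions whose fixed point has a recurrent first letter

-- There are `2 ^ k` functions from `Fin k` to `Bool`, so two of the first `2 ^ k + 1` coincide. The
-- gap is written `suc p` because it later serves as a positive exponent.
boolean-pigeonhole : (f : ℕ → Fin k → Bool) → ∃₂ λ i p → ∀ a → f i a ≡ f (i + suc p) a
boolean-pigeonhole {k} f with pigeonhole (n<1+n (2 ^ k)) (funToFin ∘ code ∘ toℕ)
  where
  code : ℕ → Fin k → Fin 2
  code n = Inverse.from 2↔Bool ∘ f n
... | i , j , i<j , eq = toℕ i , toℕ j ∸ suc (toℕ i) , λ a →
  trans (decode (toℕ i) a)
    (trans (cong (λ c → Inverse.to 2↔Bool (finToFun c a)) eq)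
      (trans (sym (decode (toℕ j) a)) (cong (λ n → f n a) (sym (trans (+-suc (toℕ i) _) (m+[n∸m]≡n i<j))))))
  where
  decode : ∀ n a → f n a ≡ Inverse.to 2↔Bool (finToFun (funToFin (Inverse.from 2↔Bool ∘ f n)) a)
  decode n a = sym (trans (cong (Inverse.to 2↔Bool) (finToFun-funToFin (Inverse.from 2↔Bool ∘ f n) a))
                          (Inverse.strictlyInverseˡ 2↔Bool (f n a)))

module FixedPoint {Φ : A → List A} {z : Seq A} (fix : Image Φ z z) (long : Expanding Φ) where

  pow-first : ∀ n → ∃ λ m → pow Φ n (z 0) ≡ prefixList z m
  pow-first n with Image.prefix (image-pow fix n) 1
  ... | m , eq = m , trans (sym (++-identityʳ _)) eq

  pow-first-long : ∀ n → ∃ λ m → n < m × pow Φ n (z 0) ≡ prefixList z m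
  pow-first-long n with pow-first n
  ... | m , eq = m , subst (n <_) (trans (cong length eq) (length-prefixList z m)) (expanding-pow long n (z 0)) , eq

  -- The power of exponent `i` applied to `z 0` is a prefix of length greater than `i`, hence covers
  -- position `i`.
  occurs-in-pow : ∀ i → z i ∈ pow Φ i (z 0)
  occurs-in-pow i with pow-first-long i
  ... | m , i<m , eq = subst (z i ∈_) (sym eq) (∈-prefixList⁺ z i<m)

  -- The second letter is recorded because, with lookahead labels, it fixes the label of the first.
  first-expands : ∃ λ xs → Φ (z 0) ≡ z 0 ∷ z 1 ∷ xs
  first-expands with pow-first-long 1
  ... | m , 2≤m , eq with prefixList-≤ z {2} {m} 2≤m
  ... | xs , eq′ = xs , trans (sym (++-identityʳ _)) (trans eq eq′)

  first-fixed : z 0 ∈ Φ (z 0)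
  first-fixed = subst (z 0 ∈_) (sym (proj₂ first-expands)) (here refl)

  letters-closed : ∀ i {b} → b ∈ Φ (z i) → ∃ λ j → z j ≡ b
  letters-closed i {b} b∈ with Image.prefix fix (suc i)
  ... | m , eq = ∈-prefixList⁻ z m (subst (b ∈_) eq (∈-concatMap-intro Φ (∈-prefixList⁺ z (n<1+n i)) b∈))

  letters-closed-pow : ∀ n i {b} → b ∈ pow Φ n (z i) → ∃ λ j → z j ≡ b
  letters-closed-pow zero i (here refl) = i , refl
  letters-closed-pow (suc n) i b∈ with ∈-concatMap-elim Φ (pow Φ n (z i)) b∈
  ... | c , c∈ , b∈Φc with letters-closed-pow n i c∈
  ... | j , refl = letters-closed j b∈Φc

  pow-first-mono : ∀ m {n b} → b ∈ pow Φ n (z 0) → b ∈ pow Φ (n + m) (z 0)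
  pow-first-mono m {n} b∈ = ∈-pow-+ Φ n m (∈-pow-self Φ first-fixed m) b∈

  -- The sets of letters of Φⁿ(z₀) increase with n, so the first repetition is their limit.
  module _ (_≟_ : DecidableEquality A) {K : ℕ} (enum : Fin K ↔ A) where
    open DecMembership _≟_ using (_∈?_)

    all-letters-in-pow : ∃ λ N → ∀ i → z i ∈ pow Φ N (z 0)
    all-letters-in-pow with boolean-pigeonhole (λ n c → does (Inverse.to enum c ∈? pow Φ n (z 0)))
    ... | N , p , same = N , λ i → stable i (occurs-in-pow i)
      where
      reflects : ∀ {m n b} → does (b ∈? pow Φ m (z 0)) ≡ does (b ∈? pow Φ n (z 0)) →
        b ∈ pow Φ n (z 0) → b ∈ pow Φ m (z 0)
      reflects {m} {n} {b} eq b∈ with b ∈? pow Φ m (z 0) | b ∈? pow Φ n (z 0)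
      ... | yes b∈m | _ = b∈m
      ... | no _ | no b∉n = contradiction b∈ b∉n

      -- Monotonicity carries `b` on to the power `N + suc p`, whose letters are exactly those of
      -- the power `N`.
      shrink : ∀ {b} → b ∈ pow Φ (suc N) (z 0) → b ∈ pow Φ N (z 0)
      shrink {b} b∈ = reflects {N} {N + suc p}
        (subst (λ b → does (b ∈? pow Φ N (z 0)) ≡ does (b ∈? pow Φ (N + suc p) (z 0)))
               (Inverse.strictlyInverseˡ enum b) (same (Inverse.from enum b)))
        (subst (λ n → b ∈ pow Φ n (z 0)) (sym (+-suc N p)) (pow-first-mono p {suc N} b∈))

      stable : ∀ n {b} → b ∈ pow Φ n (z 0) → b ∈ pow Φ N (z 0)
      stable zero (here refl) = ∈-pow-self Φ first-fixed N
      stable (suc n) b∈ with ∈-concatMap-elim Φ (pow Φ n (z 0)) b∈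
      ... | c , c∈ , b∈Φc = shrink (∈-concatMap-intro Φ (stable n c∈) b∈Φc)

    -- The alphabet is restricted to the letters occurring in `z`, listed by the power `N` of `Φ` at
    -- `z 0`. From each of them `z 0` is reached in `M` steps, and from `z 0` all of them in `N`
    -- steps.
    recurrent-image : (∃ λ M → ∀ i → z 0 ∈ pow Φ M (z i)) →
      {τ : A → List Bool} {w : BinSeq} → Image τ z w → PrimitiveSubstitutive w
    recurrent-image (M , recurrent) {τ} {w} img with all-letters-in-pow
    ... | N , occurs = length T , τ ∘ ι , Φ′ , κ ∘ z , (N + M , primitive′)
                     , Image⇒IsImage (image′ (image-⊙ (image-map κ z) fix)) , Image⇒IsImage (image′ img)
      where
      T : List A
      T = deduplicate _≟_ (pow Φ N (z 0))

      z∈T : ∀ i → z i ∈ T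
      z∈T i = ∈-deduplicate⁺ _≟_ (occurs i)

      ι : Fin (length T) → A
      ι = lookup T

      κ : A → Fin (length T)
      κ a with a ∈? T
      ... | yes a∈T = index a∈T
      -- Outside `T` any index would serve as a default; that of `z 0` is available.
      ... | no _ = index (z∈T 0)

      ικ : ∀ {a} → a ∈ T → ι (κ a) ≡ a
      ικ {a} a∈T with a ∈? T
      ... | yes a∈T′ = sym (lookup-index a∈T′)
      ... | no a∉T = contradiction a∈T a∉T

      -- This is why `T` is deduplicated: different indices must carry different letters.
      κι : ∀ j → κ (ι j) ≡ j
      κι j = lookup-injective (DecUnique.deduplicate-! _≟_ (pow Φ N (z 0))) _ j (ικ (∈-lookup j))

      Φ′ : Fin (length T) → List (Fin (length T))
      Φ′ = (([_] ∘ κ) ⊙ Φ) ∘ ι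

      ι-occurs : ∀ j → ∃ λ i → z i ≡ ι j
      ι-occurs j = letters-closed-pow N 0 (∈-deduplicate⁻ _≟_ (pow Φ N (z 0)) (∈-lookup j))

      -- Along `z` the map `ι ∘ κ` is the identity. With `f` the relabelled `Φ` this gives the new
      -- fixed point, with `f = τ` the new presentation of the target sequence.
      image′ : {B : Set} {f : A → List B} {w : Seq B} → Image f z w → Image (f ∘ ι) (κ ∘ z) w
      image′ {f = f} {w} (prefix , unbounded) =
        (λ n → proj₁ (prefix n) , trans (same n) (proj₂ (prefix n))) ,
        (λ m → proj₁ (unbounded m) , subst (m ≤_) (cong length (sym (same (proj₁ (unbounded m))))) (proj₂ (unbounded m)))
        where
        same : ∀ n → concatMap (f ∘ ι) (prefixList (κ ∘ z) n) ≡ concatMap f (prefixList z n)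
        same n = trans (cong (concatMap (f ∘ ι)) (prefixList-map κ z n))
          (trans (concatMap-map (f ∘ ι) κ (prefixList z n))
                 (concatMap-cong-∈ (prefixList z n) λ a∈ → cong f (ικ (in-T (∈-prefixList⁻ z n a∈)))))
          where
          in-T : ∀ {a} → (∃ λ i → z i ≡ a) → a ∈ T
          in-T (i , refl) = z∈T i

      -- Every intermediate letter `c` again occurs in `z`, so `ι (κ c)` is `c` and `Φ′` follows `Φ`
      -- step by step.
      κ-pow : ∀ n {j a} → a ∈ pow Φ n (ι j) → κ a ∈ pow Φ′ n j
      κ-pow zero {j} (here refl) = here (κι j)
      κ-pow (suc n) {j} {a} a∈ with ∈-concatMap-elim Φ (pow Φ n (ι j)) a∈
      ... | c , c∈ , a∈Φc with ι-occurs j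
      ... | i , zi≡ with letters-closed-pow n i (subst (λ b → c ∈ pow Φ n b) (sym zi≡) c∈)
      ... | i′ , refl = ∈-concatMap-intro Φ′ (κ-pow n c∈)
        (∈-concatMap-intro ([_] ∘ κ) (subst (λ b → a ∈ Φ b) (sym (ικ (z∈T i′))) a∈Φc) (here refl))

      -- The path from `ι j` takes `M` steps to `z 0`, one step from `z 0` to itself, and `N` steps
      -- to `ι j′`. The middle step matches the exponent `suc (N + M)` meant by `powSuc`.
      primitive′ : ∀ j j′ → 0 < powSuc (morphMatrix Φ′) (N + M) j j′
      primitive′ j j′ with ι-occurs j
      ... | i , zi≡ = ∈-pow⇒powSuc>0 Φ′ (N + M) (subst (_∈ pow Φ′ (suc (N + M)) j) (κι j′) (κ-pow (suc (N + M))
        (subst (λ a → ι j′ ∈ pow Φ (suc (N + M)) a) zi≡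
          (∈-pow-+ Φ (suc N) M (recurrent i)
            (subst (λ n → ι j′ ∈ pow Φ n (z 0)) (+-comm N 1) (∈-pow-+ Φ N 1 (pow-1 Φ first-fixed)
              (∈-deduplicate⁻ _≟_ (pow Φ N (z 0)) (∈-lookup j′))))))))

-- Normalised presentations

nonempty-image : (σ : B → List A) → (∀ b → 1 ≤ length (σ b)) →
  ∀ bs → 1 ≤ length bs → 1 ≤ length (concatMap σ bs)
nonempty-image σ nonempty bs bs>0 =
  ≤-trans bs>0 (≤-trans (≤-reflexive (sym (*-identityʳ (length bs)))) (length-concatMap-≥ σ 1 nonempty bs))

length-≥2 : {a b : A} {xs : List A} → a ≢ b → a ∈ xs → b ∈ xs → 2 ≤ length xs
length-≥2 a≢b (here a≡) (here b≡) = contradiction (trans a≡ (sym b≡)) a≢b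
length-≥2 a≢b (there a∈) _ = s≤s (∈-length a∈)
length-≥2 a≢b (here _) (there b∈) = s≤s (∈-length b∈)

unary-list : (xs ys : List (Fin 1)) → length xs ≡ length ys → xs ≡ ys
unary-list [] [] _ = refl
unary-list (zero ∷ xs) (zero ∷ ys) eq = cong (zero ∷_) (unary-list xs ys (suc-injective eq))

-- On a one-letter alphabet the identity is primitive; it is replaced by a ↦ aa, which has the same fixed point.
primitive⇒positive : {φ : Fin k → List (Fin k)} {y : Seq (Fin k)} → Primitive φ → Image φ y y →
  ∃ λ φ′ → Positive φ′ × Expanding φ′ × Image φ′ y y
primitive⇒positive {zero} {y = y} _ _ with () ← y 0
primitive⇒positive {suc zero} {y = y} _ _ =
  double , (λ { zero zero → here refl }) , (λ _ → s≤s (s≤s z≤n)) ,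
  (λ n → length (concatMap double (prefixList y n)) ,
    unary-list _ _ (sym (length-prefixList y (length (concatMap double (prefixList y n)))))) ,
  (λ m → m , (begin
    m                                         ≡⟨ length-prefixList y m ⟨
    length (prefixList y m)                   ≡⟨ *-identityʳ _ ⟨
    length (prefixList y m) * 1               ≤⟨ length-concatMap-≥ double 1 (λ _ → s≤s z≤n) (prefixList y m) ⟩
    length (concatMap double (prefixList y m)) ∎))
  where
  open ≤-Reasoning
  double : Fin 1 → List (Fin 1)
  double _ = zero ∷ zero ∷ []
-- With at least two letters, a positive image contains two different ones and so has length at
-- least 2.
primitive⇒positive {suc (suc k)} {φ} (p , prim) fix =
  pow φ (suc p) , occurs , (λ a → length-≥2 (λ ()) (occurs a zero) (occurs a (suc zero))) , image-pow fix (suc p)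
  where
  occurs : Positive (pow φ (suc p))
  occurs a b = powSuc>0⇒∈-pow φ p (prim a b)

-- `invariant` is the compatibility under which `φ` lifts to labelled letters; `f` will be the first
-- letter or the sum modulo 2.
record Presentation (f : List Bool → Bool) (w : BinSeq) : Set where
  field
    size      : ℕ
    σ         : Fin size → List Bool
    φ         : Fin size → List (Fin size)
    y         : Seq (Fin size)
    positive  : Positive φ
    expanding : Expanding φ
    fixed     : Image φ y y
    image     : Image σ y w
    nonempty  : ∀ a → 1 ≤ length (σ a)
    invariant : ∀ a → f (concatMap σ (φ a)) ≡ f (σ a)

-- The functions `a ↦ f (σ (φ₁ (φ₁ⁿ a)))` repeat at `n` and `n + suc p`. Absorbing `n` applications
-- into `σ` and taking `suc p` applications as the new morphism turns the repetition into
-- `invariant`.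
presentation : (f : List Bool → Bool) {w : BinSeq} → PrimitiveSubstitutive w → Presentation f w
presentation f {w} (k , σ , φ , y , prim , fix , img)
  with primitive⇒positive prim (IsImage⇒Image fix)
... | φ₁ , positive , expanding , fixed
  with boolean-pigeonhole (λ n a → f (concatMap (σ ⊙ φ₁) (pow φ₁ n a)))
... | n , p , same = record
  { size      = k
  ; σ         = (σ ⊙ φ₁) ⊙ pow φ₁ n
  ; φ         = pow φ₁ (suc p)
  ; y         = y
  ; positive  = positive-pow positive p
  ; expanding = λ a → ≤-trans (s≤s (s≤s z≤n)) (expanding-pow expanding (suc p) a)
  ; fixed     = image-pow fixed (suc p)
  ; image     = image-⊙ (image-⊙ img′ fixed) (image-pow fixed n)
  ; nonempty  = λ a → nonempty-image (σ ⊙ φ₁) σφ₁-nonempty (pow φ₁ n a) (≤-trans (s≤s z≤n) (expanding-pow expanding n a))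
  ; invariant = λ a → sym (trans (same a) (cong f
      (trans (cong (concatMap (σ ⊙ φ₁)) (pow-+ φ₁ n (suc p) a))
             (concatMap-concatMap (σ ⊙ φ₁) (pow φ₁ n) (pow φ₁ (suc p) a)))))
  }
  where
  img′ : Image σ y w
  img′ = IsImage⇒Image img

  member : {xs : List A} → 1 ≤ length xs → ∃ λ a → a ∈ xs
  member {xs = x ∷ _} _ = x , here refl

  -- Some `σ b` is nonempty because the image of `y` is infinite, and `b` occurs in every `φ₁ a`.
  -- Hence the extra factor `φ₁` in the new `σ`.
  σφ₁-nonempty : ∀ a → 1 ≤ length (concatMap σ (φ₁ a))
  σφ₁-nonempty a with Image.unbounded img′ 1
  ... | m , 1≤ with ∈-concatMap-elim σ (prefixList y m) (proj₂ (member 1≤))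
  ... | b , _ , c∈σb = ∈-length (∈-concatMap-intro σ (positive a b) c∈σb)

-- Finiteness of the labelled alphabet

labelled-enumeration : Fin (k * 2) ↔ (Fin k × Bool)
labelled-enumeration = (↔-id _ ×-↔ 2↔Bool) ↔-∘ *↔×

_≟L_ : DecidableEquality (Fin k × Bool)
_≟L_ = ≡-dec _≟F_ Bool._≟_

-- Labelling each letter by a datum of the following letter

-- `x` stands for the datum of whatever follows the list, which makes the labelling compatible with
-- concatenation.
firstLabel : (A → Bool) → Bool → List A → Bool
firstLabel h x [] = x
firstLabel h x (a ∷ _) = h a

lookahead : (A → Bool) → Bool → List A → List (A × Bool)
lookahead h x [] = []
lookahead h x (a ∷ as) = (a , firstLabel h x as) ∷ lookahead h x as

lookaheadSeq : (A → Bool) → Seq A → Seq (A × Bool)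
lookaheadSeq h y i = y i , h (y (suc i))

firstLabel-++ : (h : A → Bool) (x : Bool) (as bs : List A) →
  firstLabel h x (as ++ bs) ≡ firstLabel h (firstLabel h x bs) as
firstLabel-++ h x [] bs = refl
firstLabel-++ h x (a ∷ as) bs = refl

lookahead-++ : (h : A → Bool) (x : Bool) (as bs : List A) →
  lookahead h x (as ++ bs) ≡ lookahead h (firstLabel h x bs) as ++ lookahead h x bs
lookahead-++ h x [] bs = refl
lookahead-++ h x (a ∷ as) bs = cong₂ (λ l → (a , l) ∷_) (firstLabel-++ h x as bs) (lookahead-++ h x as bs)

length-lookahead : (h : A → Bool) (x : Bool) (as : List A) → length (lookahead h x as) ≡ length as
length-lookahead h x [] = refl
length-lookahead h x (a ∷ as) = cong suc (length-lookahead h x as)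

firstLabel-irrelevant : (h : A → Bool) (x x′ : Bool) (as : List A) → 1 ≤ length as → firstLabel h x as ≡ firstLabel h x′ as
firstLabel-irrelevant h x x′ (a ∷ as) _ = refl

∈-lookahead : (h : A → Bool) (x : Bool) {a : A} {as : List A} → a ∈ as → ∃ λ x′ → (a , x′) ∈ lookahead h x as
∈-lookahead h x (here refl) = _ , here refl
∈-lookahead h x (there a∈) with ∈-lookahead h x a∈
... | x′ , a,x′∈ = x′ , there a,x′∈

prefixList-lookahead : (h : A → Bool) (y : Seq A) (n : ℕ) →
  prefixList (lookaheadSeq h y) n ≡ lookahead h (h (y n)) (prefixList y n)
prefixList-lookahead h y zero = refl
prefixList-lookahead h y (suc n) =
  trans (cong (_++ [ lookaheadSeq h y n ]) (prefixList-lookahead h y n))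
        (sym (lookahead-++ h (h (y (suc n))) (prefixList y n) [ y n ]))

-- Demanding `compatible` for every `x` forces each `ρ b` to be nonempty, so the datum of a letter
-- can be read off the start of its block.
module Lookahead (hB : B → Bool) (hA : A → Bool) (ρ : B → List A)
                 (compatible : ∀ x b → firstLabel hA x (ρ b) ≡ hB b) where

  lift : B × Bool → List (A × Bool)
  lift (b , x) = lookahead hA x (ρ b)

  firstLabel-concatMap : ∀ x bs → firstLabel hA x (concatMap ρ bs) ≡ firstLabel hB x bs
  firstLabel-concatMap x [] = refl
  firstLabel-concatMap x (b ∷ bs) = trans (firstLabel-++ hA x (ρ b) (concatMap ρ bs)) (compatible _ b)

  concatMap-lift : ∀ x bs → concatMap lift (lookahead hB x bs) ≡ lookahead hA x (concatMap ρ bs)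
  concatMap-lift x [] = refl
  concatMap-lift x (b ∷ bs) = sym (trans (lookahead-++ hA x (ρ b) (concatMap ρ bs))
    (cong₂ (λ l cs → lookahead hA l (ρ b) ++ cs) (firstLabel-concatMap x bs) (sym (concatMap-lift x bs))))

  lift-image : {y : Seq B} {w : Seq A} → Image ρ y w → Image lift (lookaheadSeq hB y) (lookaheadSeq hA w)
  lift-image {y} {w} (prefix , unbounded) = lift-prefix , λ m →
      proj₁ (unbounded m) , subst (m ≤_) (sym (lift-length (proj₁ (unbounded m)))) (proj₂ (unbounded m))
    where
    lift-prefixList : ∀ n → concatMap lift (prefixList (lookaheadSeq hB y) n)
                          ≡ lookahead hA (hB (y n)) (concatMap ρ (prefixList y n))
    lift-prefixList n = trans (cong (concatMap lift) (prefixList-lookahead hB y n))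
      (concatMap-lift (hB (y n)) (prefixList y n))

    lift-length : ∀ n → length (concatMap lift (prefixList (lookaheadSeq hB y) n)) ≡ length (concatMap ρ (prefixList y n))
    lift-length n = trans (cong length (lift-prefixList n)) (length-lookahead hA (hB (y n)) (concatMap ρ (prefixList y n)))

    read-label : ∀ n m m′ as → (∀ x → firstLabel hA x as ≡ hB (y n)) →
      prefixList w m ++ as ≡ prefixList w m′ → hB (y n) ≡ hA (w m)
    read-label n m m′ [] label _ with () ← trans (label true) (sym (label false))
    read-label n m m′ (a ∷ as) label eq = trans (sym (label true)) (cong hA (sym (prefixList-next w m m′ eq)))

    -- The label of the last letter of a prefix looks one letter beyond it: the block of `y n`
    -- begins at position `m` of `w`.
    next-label : ∀ n m → concatMap ρ (prefixList y n) ≡ prefixList w m → hB (y n) ≡ hA (w m)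
    next-label n m eq with prefix (suc n)
    ... | m′ , eq′ = read-label n m m′ (ρ (y n)) (λ x → compatible x (y n)) (begin
      prefixList w m ++ ρ (y n)                                   ≡⟨ cong₂ _++_ eq (++-identityʳ (ρ (y n))) ⟨
      concatMap ρ (prefixList y n) ++ concatMap ρ [ y n ]         ≡⟨ concatMap-++ ρ (prefixList y n) [ y n ] ⟨
      concatMap ρ (prefixList y (suc n))                          ≡⟨ eq′ ⟩
      prefixList w m′                                             ∎)
      where open ≡-Reasoning

    lift-prefix : ∀ n → ∃ λ m → concatMap lift (prefixList (lookaheadSeq hB y) n) ≡ prefixList (lookaheadSeq hA w) m
    lift-prefix n with prefix n
    ... | m , eq = m , trans (lift-prefixList n) (trans (cong₂ (lookahead hA) (next-label n m eq) eq)
                                                       (sym (prefixList-lookahead hA w m)))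

-- The letters of `lookaheadSeq id v` are the pairs of consecutive letters of `v`, and adding the
-- two components gives `S v`.
presentation⇒primitiveSubstitutive-S : {v : BinSeq} → Presentation (firstLabel id false) v → PrimitiveSubstitutive (S v)
presentation⇒primitiveSubstitutive-S {v} P =
  Fixed.recurrent-image _≟L_ labelled-enumeration (2 , recurrent)
    (image-⊙ (image-map (uncurry _xor_) (lookaheadSeq id v)) (Lσ.lift-image image))
  where
  open Presentation P

  h : Fin size → Bool
  h a = firstLabel id false (σ a)

  module Lσ = Lookahead h id σ (λ x a → firstLabel-irrelevant id x false (σ a) (nonempty a))

  h-invariant : ∀ x a → firstLabel h x (φ a) ≡ h a
  h-invariant x a = trans (sym (Lσ.firstLabel-concatMap x (φ a)))
    (trans (firstLabel-irrelevant id x false (concatMap σ (φ a)) (nonempty-image σ nonempty (φ a) (∈-length (positive a a))))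
           (invariant a))

  module Lφ = Lookahead h h φ h-invariant

  z : Seq (Fin size × Bool)
  z = lookaheadSeq h y

  lift-expanding : Expanding Lφ.lift
  lift-expanding (a , x) = subst (2 ≤_) (sym (length-lookahead h x (φ a))) (expanding a)

  module Fixed = FixedPoint (Lφ.lift-image fixed) lift-expanding

  -- `φ (y 0)` starts with `y 0` and `y 1`, so the label of its first letter is determined inside
  -- the block, whatever `x` is.
  first : ∀ x → z 0 ∈ Lφ.lift (y 0 , x)
  first x with FixedPoint.first-expands {Φ = φ} {z = y} fixed expanding
  ... | as , eq = subst (λ bs → z 0 ∈ lookahead h x bs) (sym eq) (here refl)

  -- Positivity of `φ` yields some labelled copy of `y 0` in one step, and `first` turns any such
  -- copy into `z 0` in a second.
  recurrent : ∀ i → z 0 ∈ pow Lφ.lift 2 (z i)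
  recurrent i with ∈-lookahead h (h (y (suc i))) (positive (y i) (y 0))
  ... | x , y₀,x∈ = ∈-pow-+ Lφ.lift 1 1 (pow-1 Lφ.lift y₀,x∈) (pow-1 Lφ.lift (first x))

-- Labelling each letter by a running sum modulo 2

total : (A → Bool) → List A → Bool
total g [] = false
total g (a ∷ as) = g a xor total g as

runningSum : (A → Bool) → Bool → List A → List (A × Bool)
runningSum g s [] = []
runningSum g s (a ∷ as) = (a , s) ∷ runningSum g (s xor g a) as

runningSumSeq : (A → Bool) → Bool → Seq A → Seq (A × Bool)
runningSumSeq g s y i = y i , s xor total g (prefixList y i)

total-++ : (g : A → Bool) (as bs : List A) → total g (as ++ bs) ≡ total g as xor total g bs
total-++ g [] bs = refl
total-++ g (a ∷ as) bs = trans (cong (g a xor_) (total-++ g as bs)) (sym (xor-assoc (g a) (total g as) (total g bs)))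

runningSum-++ : (g : A → Bool) (s : Bool) (as bs : List A) →
  runningSum g s (as ++ bs) ≡ runningSum g s as ++ runningSum g (s xor total g as) bs
runningSum-++ g s [] bs = cong (λ t → runningSum g t bs) (sym (xor-identityʳ s))
runningSum-++ g s (a ∷ as) bs = cong ((a , s) ∷_) (trans (runningSum-++ g (s xor g a) as bs)
  (cong (λ t → runningSum g (s xor g a) as ++ runningSum g t bs) (xor-assoc s (g a) (total g as))))

length-runningSum : (g : A → Bool) (s : Bool) (as : List A) → length (runningSum g s as) ≡ length as
length-runningSum g s [] = refl
length-runningSum g s (a ∷ as) = cong suc (length-runningSum g (s xor g a) as)

∈-runningSum : (g : A → Bool) (s : Bool) {a : A} {as : List A} → a ∈ as → ∃ λ t → (a , t) ∈ runningSum g s as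
∈-runningSum g s (here refl) = s , here refl
∈-runningSum g s {as = b ∷ _} (there a∈) with ∈-runningSum g (s xor g b) a∈
... | t , a,t∈ = t , there a,t∈

prefixList-runningSum : (g : A → Bool) (s : Bool) (y : Seq A) (n : ℕ) →
  prefixList (runningSumSeq g s y) n ≡ runningSum g s (prefixList y n)
prefixList-runningSum g s y zero = refl
prefixList-runningSum g s y (suc n) =
  trans (cong (_++ [ runningSumSeq g s y n ]) (prefixList-runningSum g s y n))
        (sym (runningSum-++ g s (prefixList y n) [ y n ]))

flipLabel : A × Bool → A × Bool
flipLabel (a , s) = a , not s

-- The starting value is a summand of every label, so negating it negates them all.
∈-runningSum-flip : (g : A → Bool) (s : Bool) {c : A × Bool} (as : List A) →
  c ∈ runningSum g s as → flipLabel c ∈ runningSum g (not s) as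
∈-runningSum-flip g s (a ∷ as) (here refl) = here refl
∈-runningSum-flip g s {c} (a ∷ as) (there c∈) =
  there (subst (λ t → flipLabel c ∈ runningSum g t as) (not-distribˡ-xor s (g a)) (∈-runningSum-flip g (s xor g a) as c∈))

module RunningSum (gB : B → Bool) (gA : A → Bool) (ρ : B → List A)
                  (compatible : ∀ b → total gA (ρ b) ≡ gB b) where

  lift : B × Bool → List (A × Bool)
  lift (b , s) = runningSum gA s (ρ b)

  total-concatMap : ∀ bs → total gA (concatMap ρ bs) ≡ total gB bs
  total-concatMap [] = refl
  total-concatMap (b ∷ bs) = trans (total-++ gA (ρ b) (concatMap ρ bs)) (cong₂ _xor_ (compatible b) (total-concatMap bs))

  concatMap-lift : ∀ s bs → concatMap lift (runningSum gB s bs) ≡ runningSum gA s (concatMap ρ bs)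
  concatMap-lift s [] = refl
  concatMap-lift s (b ∷ bs) = sym (trans (runningSum-++ gA s (ρ b) (concatMap ρ bs))
    (cong (runningSum gA s (ρ b) ++_)
      (trans (cong (λ t → runningSum gA (s xor t) (concatMap ρ bs)) (compatible b))
             (sym (concatMap-lift (s xor gB b) bs)))))

  lift-image : ∀ s {y : Seq B} {w : Seq A} → Image ρ y w → Image lift (runningSumSeq gB s y) (runningSumSeq gA s w)
  lift-image s {y} {w} (prefix , unbounded) = lift-prefix , λ m →
      proj₁ (unbounded m) , subst (m ≤_) (sym (lift-length (proj₁ (unbounded m)))) (proj₂ (unbounded m))
    where
    lift-prefixList : ∀ n → concatMap lift (prefixList (runningSumSeq gB s y) n)
                          ≡ runningSum gA s (concatMap ρ (prefixList y n))
    lift-prefixList n = trans (cong (concatMap lift) (prefixList-runningSum gB s y n)) (concatMap-lift s (prefixList y n))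

    lift-length : ∀ n → length (concatMap lift (prefixList (runningSumSeq gB s y) n)) ≡ length (concatMap ρ (prefixList y n))
    lift-length n = trans (cong length (lift-prefixList n)) (length-runningSum gA s (concatMap ρ (prefixList y n)))

    lift-prefix : ∀ n → ∃ λ m → concatMap lift (prefixList (runningSumSeq gB s y) n) ≡ prefixList (runningSumSeq gA s w) m
    lift-prefix n with prefix n
    ... | m , eq = m , trans (lift-prefixList n) (trans (cong (runningSum gA s) eq) (sym (prefixList-runningSum gA s w m)))

∈-pow-flip : (Φ : A × Bool → List (A × Bool)) → (∀ {c d} → d ∈ Φ c → flipLabel d ∈ Φ (flipLabel c)) →
  ∀ n {c d} → d ∈ pow Φ n c → flipLabel d ∈ pow Φ n (flipLabel c)
∈-pow-flip Φ flip zero (here refl) = here refl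
∈-pow-flip Φ flip (suc n) {c} d∈ with ∈-concatMap-elim Φ (pow Φ n c) d∈
... | e , e∈ , d∈Φe = ∈-concatMap-intro Φ (∈-pow-flip Φ flip n e∈) (flip d∈Φe)

-- The sum telescopes modulo 2. Thus the running-sum labels of `S v` started at `v 0` spell `v`.
runningSum-S : (v : BinSeq) (i : ℕ) → v 0 xor total id (prefixList (S v) i) ≡ v i
runningSum-S v zero = xor-identityʳ (v 0)
runningSum-S v (suc i) = begin
  v 0 xor total id (prefixList (S v) i ++ [ S v i ])              ≡⟨ cong (v 0 xor_) (total-++ id (prefixList (S v) i) [ S v i ]) ⟩
  v 0 xor (total id (prefixList (S v) i) xor (S v i xor false))   ≡⟨ xor-assoc (v 0) _ _ ⟨
  (v 0 xor total id (prefixList (S v) i)) xor (S v i xor false)   ≡⟨ cong₂ _xor_ (runningSum-S v i) (xor-identityʳ (S v i)) ⟩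
  v i xor (v i xor v (suc i))                                     ≡⟨ xor-assoc (v i) (v i) (v (suc i)) ⟨
  (v i xor v i) xor v (suc i)                                     ≡⟨ cong (_xor v (suc i)) (xor-same (v i)) ⟩
  v (suc i)                                                       ∎
  where open ≡-Reasoning

presentation⇒primitiveSubstitutive-S⁻¹ : {v : BinSeq} → Presentation (total id) (S v) → PrimitiveSubstitutive v
presentation⇒primitiveSubstitutive-S⁻¹ {v} P =
  Fixed.recurrent-image _≟L_ labelled-enumeration (N + 1 , recurrent)
    (image-cong (runningSum-S v) (image-⊙ (image-map proj₂ (runningSumSeq id (v 0) (S v))) (Rσ.lift-image (v 0) image)))
  where
  open Presentation P

  g : Fin size → Bool
  g a = total id (σ a)

  module Rσ = RunningSum g id σ (λ _ → refl)
  module Rφ = RunningSum g g φ (λ a → trans (sym (Rσ.total-concatMap (φ a))) (invariant a))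

  z : Seq (Fin size × Bool)
  z = runningSumSeq g (v 0) y

  lift-expanding : Expanding Rφ.lift
  lift-expanding (a , s) = subst (2 ≤_) (sym (length-runningSum g s (φ a))) (expanding a)

  module Fixed = FixedPoint (Rφ.lift-image (v 0) fixed) lift-expanding

  N : ℕ
  N = proj₁ (Fixed.all-letters-in-pow _≟L_ labelled-enumeration)

  flip-closed : ∀ {c d} → d ∈ Rφ.lift c → flipLabel d ∈ Rφ.lift (flipLabel c)
  flip-closed {a , s} = ∈-runningSum-flip g s (φ a)

  return : ∀ s {i} → z i ≡ (y 0 , s) → z 0 ∈ pow Rφ.lift N (y 0 , s)
  return s {i} zi≡ with s Bool.≟ proj₂ (z 0)
  ... | yes refl = ∈-pow-self Rφ.lift Fixed.first-fixed N
  -- Here `(y 0 , s)` is the flipped `z 0`. As it occurs in `z`, it lies in the power `N` at `z 0`;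
  -- flipping source and target reverses the relation.
  ... | no s≢ = subst (λ c → c ∈ pow Rφ.lift N (y 0 , s)) (cong (y 0 ,_) (sym (Bool.¬-not (s≢ ∘ sym))))
      (subst (λ t → (y 0 , not s) ∈ pow Rφ.lift N (y 0 , t)) (sym (Bool.¬-not s≢))
        (∈-pow-flip Rφ.lift flip-closed N
          (subst (_∈ pow Rφ.lift N (z 0)) zi≡ (proj₂ (Fixed.all-letters-in-pow _≟L_ labelled-enumeration) i))))

  -- One step reaches a copy of `y 0` by positivity; that copy occurs in `z`, as `return` requires,
  -- and `N` further steps lead to `z 0`.
  recurrent : ∀ i → z 0 ∈ pow Rφ.lift (N + 1) (z i)
  recurrent i with ∈-runningSum g (proj₂ (z i)) (positive (y i) (y 0))
  ... | s , y₀,s∈ with Fixed.letters-closed i y₀,s∈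
  ... | j , zj≡ = ∈-pow-+ Rφ.lift N 1 (pow-1 Rφ.lift y₀,s∈) (return s zj≡)

-- Transfer along pointwise equality and the equivalence

primitiveSubstitutive-cong : {w w′ : BinSeq} → (∀ i → w i ≡ w′ i) → PrimitiveSubstitutive w → PrimitiveSubstitutive w′
primitiveSubstitutive-cong w≗w′ (k , σ , φ , y , prim , fix , img) =
  k , σ , φ , y , prim , fix , Image⇒IsImage (image-cong w≗w′ (IsImage⇒Image img))

theorem6p3 : (v u : BinSeq) → CSRote v → StandardSturmian u → (∀ i → u i ≡ S v i) →
    PrimitiveSubstitutive v ⇔ PrimitiveSubstitutive u
theorem6p3 v u _ _ u≗Sv = mk⇔
  (primitiveSubstitutive-cong (sym ∘ u≗Sv) ∘ presentation⇒primitiveSubstitutive-S ∘ presentation (firstLabel id false))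
  (presentation⇒primitiveSubstitutive-S⁻¹ ∘ presentation (total id) ∘ primitiveSubstitutive-cong u≗Sv)
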